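{- Let $\lambda$ be a partition and let $h_1,h_2,\dots,h_s$ be a sequence of rim-hooks of $\lambda$ such that $h_i\leq h_{i+1}$ for all $i\in\{1,\dots,s-1\}$ (in the reverse lexicographic order on rim-hooks). Then for every $i\in\{1,\dots,s\}$ the rim-hook $h_i$ inserts into the reverse plane partition $h_{i+1}*\dots*h_s*0$, where $0$ denotes the zero reverse plane partition of shape $\lambda$ (for $i=s$ this is $0$ itself). In particular $h_1*h_2*\dots*h_s*0$ is a well-defined reverse plane partition of shape $\lambda$.
   Context: Cells are pairs $u=(u_1,u_2)\in\mathbb{Z}^2$ (row, column). Neighbours: $\mathrm{n}u=(u_1-1,u_2)$, $\mathrm{e}u=(u_1,u_2+1)$, $\mathrm{s}u=(u_1+1,u_2)$, $\mathrm{w}u=(u_1,u_2-1)$. The content of $u$ is $c(u)=u_2-u_1$. A partition $\lambda_1\ge\dots\ge\lambda_r>0$ is identified with its Young diagram $\lambda=\{(i,j):1\le i\le r,\ 1\le j\le\lambda_i\}$; $\lambda'$ is the conjugate partition. A reverse plane partition of shape $\lambda$ is a map $\pi:\lambda\to\mathbb{N}=\{0,1,2,\dots\}$ with $\pi(u)\le\pi(\mathrm{e}u)$ and $\pi(u)\le\pi(\mathrm{s}u)$ whenever these cells lie in $\lambda$; by convention $\pi(u)=0$ if $u_1\le0$ or $u_2\le0$, and $\pi(u)=\infty$ if $u_1,u_2\ge1$ but $u\notin\lambda$. A North-East-path in $\lambda$ is a sequence $P=(u_0,\dots,u_s)$ of cells of $\lambda$ with $u_k\in\{\mathrm{n}u_{k-1},\mathrm{e}u_{k-1}\}$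 for $k=1,\dots,s$; its length is $\ell(P)=s$, head $\alpha(P)=u_0$, tail $\omega(P)=u_s$. A rim-hook of $\lambda$ is a North-East-path $h$ in $\lambda$ with $\mathrm{s}\alpha(h)\notin\lambda$, $\mathrm{e}\omega(h)\notin\lambda$, and $\mathrm{e}\mathrm{s}u\notin\lambda$ for all $u\in h$. For each cell $(i,j)\in\lambda$ there is a unique rim-hook with $\alpha(h)=(\lambda'_j,j)$ and $\omega(h)=(i,\lambda_i)$, giving a bijection between cells and rim-hooks. The reverse lexicographic order on cells is: $u\le v$ iff $u_2>v_2$, or $u_2=v_2$ and $u_1\ge v_1$; it is transferred to rim-hooks via this bijection. Equivalently, $f\le h$ iff $c(\alpha(f))>c(\alpha(h))$, or $c(\alpha(f))=c(\alpha(h))$ and $c(\omega(f))\le c(\omega(h))$. A cell $u\in\lambda$ is an outer corner if $\mathrm{e}u,\mathrm{s}u\notin\lambda$, and an inner corner if $\mathrm{e}u,\mathrm{s}u\in\lambda$ but $\mathrm{e}\mathrm{s}u\notin\lambda$. Let $i_1,\dots,i_r$ be the contents of the inner corners and $o_1,\dots,o_{r+1}$ those of the outer corners, ordered so that $o_1<i_1<o_2<\dots<o_r<i_r<o_{r+1}$. Define $\mathcal{I}=\{u\in\lambda:c(u)=i_k\text{ for some }k\}$, $\mathcal{O}=\{u\in\lambda:c(u)=o_k\text{ for some }k\}$, $\mathcal{A}=\{u\in\lambda:c(u)<o_1\text{ or }i_k<c(u)<o_{k+1}\text{ for some }k\in[r]\}$, $\mathcal{B}=\{u\in\lambda:o_k<c(u)<i_k\text{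 for some }k\in[r]\text{ or }c(u)>o_{r+1}\}$. For a reverse plane partition $\pi$ and a path $P$ in $\lambda$, $\pi\pm P:\lambda\to\mathbb{Z}$ is given by $(\pi\pm P)(u)=\pi(u)\pm1$ if $u\in P$ and $\pi(u)$ otherwise. $P$ is $\pi$-compatible if (1) whenever $u\in P$ and $u\in\mathcal{I}\cup\mathcal{A}$, then $\mathrm{e}u\in P$ and $\pi(\mathrm{e}u)=\pi(u)$; and (2) whenever $u,\mathrm{n}u\in P$, then $\pi(\mathrm{n}u)=\pi(u)$. A rim-hook $h$ inserts into $\pi$ if there is a $\pi$-compatible North-East-path $P$ in $\lambda$ with $\omega(P)=\omega(h)$, $\ell(P)=\ell(h)$ and $\pi+P$ a reverse plane partition; such $P$ is unique, and one defines $h*\pi=\pi+P$. -}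

module Defs where

open import Data.Nat as ℕ using (ℕ; zero; suc; pred; _≤_; _<_; _≥_)
open import Data.Nat.Properties using () renaming (_≟_ to _≟ℕ_)
open import Data.Integer as ℤ using (ℤ; +_)
open import Data.Product using (_×_; _,_; Σ; ∃; proj₁; proj₂)
open import Data.Product.Properties using (≡-dec)
open import Data.Sum using (_⊎_)
open import Data.List using (List; []; _∷_; length; lookup)
open import Data.List.Relation.Unary.All using (All)
open import Data.List.Relation.Unary.Linked using (Linked)
open import Data.List.Membership.Propositional using (_∈_)
open import Data.List.Membership.DecPropositional (≡-dec _≟ℕ_ _≟ℕ_) using (_∈?_)
open import Relation.Binary.PropositionalEquality using (_≡_)
open import Relation.Nullary using (¬_; does)
open import Data.Bool using (if_then_else_)

Partition : Set
Partition = List ℕ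

IsPartition : Partition → Set
IsPartition λ′ = Linked _≥_ λ′ × All (λ k → 0 < k) λ′

-- Cells (row , column); cells of a Young diagram are 1-indexed,
-- so ℕ × ℕ contains all of them.
Cell : Set
Cell = ℕ × ℕ

row col : Cell → ℕ
row = proj₁
col = proj₂

-- λ_i for i ≥ 1 (0 if i > r); λ_0 is irrelevant (set to 0)
rowLen : Partition → ℕ → ℕ
rowLen []       _             = 0
rowLen (_ ∷ _)  zero          = 0
rowLen (x ∷ _)  (suc zero)    = x
rowLen (_ ∷ xs) (suc (suc i)) = rowLen xs (suc i)

InShape : Partition → Cell → Set
InShape λ′ (i , j) = 1 ≤ i × 1 ≤ j × j ≤ rowLen λ′ i

-- neighbours (north is only ever applied to cells of λ, whose row is ≥ 1)
north east south : Cell → Cell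
north (i , j) = (pred i , j)
east  (i , j) = (i , suc j)
south (i , j) = (suc i , j)

content : Cell → ℤ
content (i , j) = + j ℤ.- + i

IsOuterCorner : Partition → Cell → Set
IsOuterCorner λ′ u = InShape λ′ u × ¬ InShape λ′ (east u) × ¬ InShape λ′ (south u)

IsInnerCorner : Partition → Cell → Set
IsInnerCorner λ′ u =
  InShape λ′ u × InShape λ′ (east u) × InShape λ′ (south u) × ¬ InShape λ′ (east (south u))

IsOuterContent IsInnerContent : Partition → ℤ → Set
IsOuterContent λ′ x = Σ Cell λ v → IsOuterCorner λ′ v × content v ≡ x
IsInnerContent λ′ x = Σ Cell λ v → IsInnerCorner λ′ v × content v ≡ x

InI : Partition → Cell → Set
InI λ′ u = InShape λ′ u × IsInnerContent λ′ (content u)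

-- 𝓐 = { u ∈ λ : c(u) < o₁  or  i_k < c(u) < o_{k+1} for some k }.
-- o₁ is the least outer content; o_{k+1} is the least outer content
-- exceeding i_k (by the interlacing o₁ < i₁ < o₂ < … ).
InA : Partition → Cell → Set
InA λ′ u = InShape λ′ u ×
  ( (∀ o → IsOuterContent λ′ o → content u ℤ.< o)
  ⊎ Σ ℤ λ i → IsInnerContent λ′ i × i ℤ.< content u ×
      (∀ o → IsOuterContent λ′ o → i ℤ.< o → content u ℤ.< o))

-- A path (u₀, u₁, …, u_s) is stored as its head u₀ and the list (u₁,…,u_s).
Path : Set
Path = Cell × List Cell

cells : Path → List Cell
cells (u , us) = u ∷ us

len : Path → ℕ
len (_ , us) = length us

head : Path → Cell
head = proj₁

lastCell : Cell → List Cell → Cell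
lastCell u []       = u
lastCell _ (v ∷ vs) = lastCell v vs

tail : Path → Cell
tail (u , us) = lastCell u us

NEStep : Cell → Cell → Set
NEStep u v = v ≡ north u ⊎ v ≡ east u

IsNEPath : Partition → Path → Set
IsNEPath λ′ P = All (InShape λ′) (cells P) × Linked NEStep (cells P)

IsRimHook : Partition → Path → Set
IsRimHook λ′ h =
  IsNEPath λ′ h × ¬ InShape λ′ (south (head h)) × ¬ InShape λ′ (east (tail h))
  × All (λ u → ¬ InShape λ′ (east (south u))) (cells h)

_≤revlex_ : Cell → Cell → Set
u ≤revlex v = col u ℕ.> col v ⊎ (col u ≡ col v × row u ≥ row v)

-- the cell (i , j) corresponding to a rim-hook with α = (λ'_j , j), ω = (i , λ_i)
cellOf : Path → Cell
cellOf h = (row (tail h) , col (head h))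

_≤hook_ : Path → Path → Set
h ≤hook f = cellOf h ≤revlex cellOf f

RPP : Set
RPP = Cell → ℕ   -- values outside λ are irrelevant

IsRPP : Partition → RPP → Set
IsRPP λ′ π = ∀ u → InShape λ′ u →
  (InShape λ′ (east u) → π u ≤ π (east u)) × (InShape λ′ (south u) → π u ≤ π (south u))

zeroRPP : RPP
zeroRPP _ = 0

_+P_ : RPP → Path → RPP
(π +P P) u = if does (u ∈? cells P) then suc (π u) else π u

IsCompatible : Partition → RPP → Path → Set
IsCompatible λ′ π P =
  (∀ u → u ∈ cells P → InI λ′ u ⊎ InA λ′ u → east u ∈ cells P × π (east u) ≡ π u)
  × (∀ u → u ∈ cells P → north u ∈ cells P → π (north u) ≡ π u)

-- P witnesses that h inserts into π (and then h * π = π +P P)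
InsertionPath : Partition → Path → RPP → Path → Set
InsertionPath λ′ h π P =
  IsNEPath λ′ P × IsCompatible λ′ π P × tail P ≡ tail h × len P ≡ len h × IsRPP λ′ (π +P P)

-- InsertChain λ (h₁ ∷ … ∷ h_s ∷ []) ρ : each h_i inserts into
-- h_{i+1} * … * h_s * 0, and ρ = h₁ * … * h_s * 0.
data InsertChain (λ′ : Partition) : List Path → RPP → Set where
  done : InsertChain λ′ [] zeroRPP
  step : ∀ {h hs π} (P : Path) → InsertChain λ′ hs π → InsertionPath λ′ h π P →
         InsertChain λ′ (h ∷ hs) (π +P P)

{-# OPTIONS --safe #-}
module Submission where

-- The insertion path of h is built backwards from ω(h): from v it continues to the south
-- neighbour if that lies in λ and carries the same value as v, and to the west neighbour
-- otherwise. Read as partitions, the values on the diagonals change along this path as in RSK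
-- row insertion: every diagonal receives one box.
--
-- The hooks arrive column by column, so on the contents ≥ c(α(h)) every earlier path that
-- meets a diagonal also meets all diagonals between it and c(α(h)). Hence the two diagonals at
-- an eastward step of the rim carry equal values, which is compatibility (1). The path could
-- only fail by leaving λ through column 1. After the hooks with head in columns ≤ j, at most
-- the j outermost cells of a diagonal are nonzero, so a path for a new column is never pushed
-- too far; and within a column every path runs weakly south-east of the preceding one.

open import Defs
open import Data.Nat using (ℕ; zero; suc; pred; _+_; _≤_; _<_; _≥_; z≤n; s≤s; _≟_; _≤?_)
open import Data.Nat.Properties
open import Data.Nat.Solver using (module +-*-Solver)
open import Data.Integer as ℤ using (+_)
import Data.Integer.Properties as ℤP
import Data.Integer.Solver as ℤSolver
open import Data.Bool using (if_then_else_)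
open import Data.Unit using (⊤; tt)
open import Data.Product using (_×_; _,_; Σ; ∃; proj₁; proj₂)
open import Data.Product.Properties using (≡-dec)
open import Data.Sum using (_⊎_; inj₁; inj₂)
open import Data.List using (List; []; _∷_; length)
open import Data.List.Membership.Propositional using (_∈_; _∉_)
open import Data.List.Membership.DecPropositional (≡-dec _≟_ _≟_) using (_∈?_)
open import Data.List.Relation.Unary.Any using (here; there)
open import Data.List.Relation.Unary.All as All using (All; []; _∷_)
open import Data.List.Relation.Unary.Linked using (Linked; []; [-]; _∷_)
open import Function using (_∘_)
open import Relation.Nullary using (¬_; Dec; yes; no; contradiction)
open import Relation.Nullary.Decidable using (_×-dec_; dec-true; dec-false; decidable-stable)
open import Relation.Binary.PropositionalEquality
  using (_≡_; _≢_; refl; sym; trans; cong; cong₂; subst; subst₂)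

-- Row lengths of a partition

rowLen-antitone : ∀ {xs i i′} → Linked _≥_ xs → 1 ≤ i → i ≤ i′ → rowLen xs i′ ≤ rowLen xs i
rowLen-antitone {[]} _ _ _ = z≤n
rowLen-antitone {_ ∷ _} {suc zero} {suc zero} _ _ _ = ≤-refl
rowLen-antitone {_ ∷ []} {suc zero} {suc (suc _)} _ _ _ = z≤n
rowLen-antitone {_ ∷ _ ∷ _} {suc zero} {suc (suc k)} (x≥y ∷ l) _ _ =
  ≤-trans (rowLen-antitone {i = 1} {suc k} l ≤-refl (s≤s z≤n)) x≥y
rowLen-antitone {_ ∷ []} {suc (suc _)} {suc zero} _ _ (s≤s ())
rowLen-antitone {_ ∷ []} {suc (suc _)} {suc (suc _)} _ _ _ = z≤n
rowLen-antitone {_ ∷ _ ∷ _} {suc (suc i)} {suc (suc i′)} (_ ∷ l) _ (s≤s i≤i′) =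
  rowLen-antitone {i = suc i} {suc i′} l (s≤s z≤n) i≤i′

rowLen≡0 : ∀ xs {i} → length xs < i → rowLen xs i ≡ 0
rowLen≡0 [] _ = refl
rowLen≡0 (_ ∷ xs) {suc (suc i)} (s≤s l) = rowLen≡0 xs {suc i} l

-- Contents and diagonals without subtraction

private
  -- Adding both rows to a content clears its subtraction, so the contents of two cells can be
  -- compared in `ℕ`.
  cross : ∀ u v → content u ℤ.+ + (row u + row v) ≡ + (col u + row v)
  cross (i , j) (i′ , j′) = trans
    (cong (λ z → content (i , j) ℤ.+ z) (ℤP.pos-+ i i′))
    (trans (solve 3 (λ a b c → (a :- b) :+ (b :+ c) := a :+ c) refl (+ j) (+ i) (+ i′))
           (sym (ℤP.pos-+ j i′)))
    where open ℤSolver.+-*-Solver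

  cross′ : ∀ u v → content v ℤ.+ + (row u + row v) ≡ + (col v + row u)
  cross′ u v = trans (cong (λ n → content v ℤ.+ + n) (+-comm (row u) (row v))) (cross v u)

content-≡ : ∀ u v → content u ≡ content v → col u + row v ≡ col v + row u
content-≡ u v eq = ℤP.+-injective
  (trans (sym (cross u v)) (trans (cong (λ z → z ℤ.+ + (row u + row v)) eq) (cross′ u v)))

content-< : ∀ u v → content u ℤ.< content v → col u + row v < col v + row u
content-< u v lt = ℤP.drop‿+<+
  (subst₂ ℤ._<_ (cross u v) (cross′ u v) (ℤP.+-monoˡ-< (+ (row u + row v)) lt))

<-content : ∀ u v → col u + row v < col v + row u → content u ℤ.< content v
<-content u v lt = ℤP.≰⇒> λ v≤u → <⇒≱ lt (ℤP.drop‿+≤+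
  (subst₂ ℤ._≤_ (cross′ u v) (cross u v) (ℤP.+-monoˡ-≤ (+ (row u + row v)) v≤u)))

shift : ℕ → Cell → Cell
shift k (i , j) = (i + k , j + k)

shift-0 : ∀ u → shift 0 u ≡ u
shift-0 (i , j) = cong₂ _,_ (+-identityʳ i) (+-identityʳ j)

shift-suc : ∀ k u → shift (suc k) u ≡ shift k (east (south u))
shift-suc k (i , j) = cong₂ _,_ (+-suc i k) (+-suc j k)

shift-shift : ∀ k l u → shift l (shift k u) ≡ shift (k + l) u
shift-shift k l (i , j) = cong₂ _,_ (+-assoc i k l) (+-assoc j k l)

-- c(v) = c(α) + n
AtOffset : Cell → ℕ → Cell → Set
AtOffset α n v = col v + row α ≡ n + col α + row v

-- c(α) ≤ c(v)
Beyond : Cell → Cell → Set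
Beyond α v = col α + row v ≤ col v + row α

beyond : ∀ {α n} v → AtOffset α n v → Beyond α v
beyond {α} {n} v d = ≤-trans (+-monoˡ-≤ (row v) (m≤n+m (col α) n)) (≤-reflexive (sym d))

offset : ∀ {α} v → Beyond α v → ∃ λ n → AtOffset α n v
offset {α} v b with m≤n⇒∃[o]m+o≡n b
... | n , eq = n , trans (sym eq)
  (trans (+-comm (col α + row v) n) (sym (+-assoc n (col α) (row v))))

offset-west : ∀ {α n i j} → AtOffset α (suc n) (i , suc j) → AtOffset α n (i , j)
offset-west = suc-injective

offset-south : ∀ {α n} v → AtOffset α (suc n) v → AtOffset α n (south v)
offset-south {α} {n} v d = trans d (sym (+-suc (n + col α) (row v)))

offset-east : ∀ {α n} v → AtOffset α n v → AtOffset α (suc n) (east v)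
offset-east _ = cong suc

offset-north : ∀ {α n} v → AtOffset α n (south v) → AtOffset α (suc n) v
offset-north {α} {n} v d = trans d (+-suc (n + col α) (row v))

offset-unique : ∀ {α m n} v → AtOffset α m v → AtOffset α n v → m ≡ n
offset-unique {α} {m} {n} v d e =
  +-cancelʳ-≡ (col α) m n (+-cancelʳ-≡ (row v) (m + col α) (n + col α) (trans (sym d) e))

offset-shift : ∀ {α n} k v → AtOffset α n v → AtOffset α n (shift k v)
offset-shift {a , b} {n} k (i , j) d =
  trans (solve 3 (λ j a k → (j :+ k) :+ a := (j :+ a) :+ k) refl j a k)
        (trans (cong (_+ k) d) (+-assoc (n + b) i k))
  where open +-*-Solver

offset-unshift : ∀ {α n} k v → AtOffset α n (shift k v) → AtOffset α n v
offset-unshift {a , b} {n} k (i , j) d = +-cancelʳ-≡ k (j + a) (n + b + i)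
  (trans (solve 3 (λ j a k → (j :+ a) :+ k := (j :+ k) :+ a) refl j a k)
         (trans d (sym (+-assoc (n + b) i k))))
  where open +-*-Solver

same-diagonal : ∀ {α n} u v → AtOffset α n u → AtOffset α n v → row u ≤ row v →
                ∃ λ k → v ≡ shift k u
same-diagonal {a , b} {n} (i , j) (i′ , j′) d e i≤i′ with m≤n⇒∃[o]m+o≡n i≤i′
... | k , refl = k , cong (i + k ,_) (+-cancelʳ-≡ a j′ (j + k)
  (trans e (trans (sym (+-assoc (n + b) i k)) (trans (cong (_+ k) (sym d))
    (solve 3 (λ j a k → (j :+ a) :+ k := (j :+ k) :+ a) refl j a k)))))
  where open +-*-Solver

shift-col-≤ : ∀ k u → col (shift k u) ≤ col u → shift k u ≡ u
shift-col-≤ zero u _ = shift-0 u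
shift-col-≤ (suc k) (i , j) le = contradiction
  (m+n≤o⇒m≤o (suc j) (≤-trans (≤-reflexive (sym (+-suc j k))) le)) 1+n≰n

-- y lies weakly north-east of x
_⊑_ : Cell → Cell → Set
x ⊑ y = row y ≤ row x × col x ≤ col y

⊑-refl : ∀ {x} → x ⊑ x
⊑-refl = ≤-refl , ≤-refl

⊑-trans : ∀ {x y z} → x ⊑ y → y ⊑ z → x ⊑ z
⊑-trans (a , b) (c , d) = ≤-trans c a , ≤-trans b d

-- Values after adding a path

+P-∈ : ∀ π P {u} → u ∈ cells P → (π +P P) u ≡ suc (π u)
+P-∈ π P {u} u∈ = cong (if_then suc (π u) else π u) (dec-true (u ∈? cells P) u∈)

+P-∉ : ∀ π P {u} → u ∉ cells P → (π +P P) u ≡ π u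
+P-∉ π P {u} u∉ = cong (if_then suc (π u) else π u) (dec-false (u ∈? cells P) u∉)

+P-≥ : ∀ π P u → π u ≤ (π +P P) u
+P-≥ π P u with u ∈? cells P
... | yes u∈ = ≤-trans (n≤1+n (π u)) (≤-reflexive (sym (+P-∈ π P u∈)))
... | no u∉ = ≤-reflexive (sym (+P-∉ π P u∉))

-- Diagonals through 𝓘 and 𝓐

module _ (lam : Partition) (antitone : Linked _≥_ lam) where

  private
    S : Cell → Set
    S = InShape lam

  InShape? : ∀ u → Dec (S u)
  InShape? (i , j) = (1 ≤? i) ×-dec ((1 ≤? j) ×-dec (j ≤? rowLen lam i))

  InShape-≤ : ∀ {u v} → S v → 1 ≤ row u → 1 ≤ col u → row u ≤ row v → col u ≤ col v → S u
  InShape-≤ (_ , _ , c) p q r s =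
    p , q , ≤-trans s (≤-trans c (rowLen-antitone antitone p r))

  InShape-west : ∀ {i j} → S (i , suc (suc j)) → S (i , suc j)
  InShape-west s = InShape-≤ s (proj₁ s) (s≤s z≤n) ≤-refl (n≤1+n _)

  InShape-unshift : ∀ k {u} → S u → ∀ {l} → l ≤ k → S (shift k u) → S (shift l u)
  InShape-unshift k {i , j} (p , q , _) {l} l≤k s =
    InShape-≤ s (≤-trans p (m≤m+n i l)) (≤-trans q (m≤m+n j l))
      (+-monoʳ-≤ i l≤k) (+-monoʳ-≤ j l≤k)

  -- For u in λ: the rim cell on the diagonal of u has its east neighbour in λ, that is,
  -- u ∈ 𝓘 ∪ 𝓐. Only the implication from 𝓘 ∪ 𝓐 is needed.
  EastExit : Cell → Set
  EastExit u = ∀ k → S (shift k u) → S (east (shift k u))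

  eastExit-here : ∀ {u} → EastExit u → S u → S (east u)
  eastExit-here {u} e s =
    subst (S ∘ east) (shift-0 u) (e 0 (subst S (sym (shift-0 u)) s))

  eastExit-es : ∀ {u} → EastExit u → EastExit (east (south u))
  eastExit-es {u} e k s =
    subst (S ∘ east) (shift-suc k u) (e (suc k) (subst S (sym (shift-suc k u)) s))

  -- Let `(a , b)` be the inner corner on the diagonal of u. A diagonal cell in a row up to a has
  -- its east neighbour weakly north-west of `(a , suc b)`, hence in λ; one further south would pull
  -- `(suc a , suc b)` into λ.
  InI⇒eastExit : ∀ {u} → InI lam u → EastExit u
  InI⇒eastExit {i , j} ((p , q , _) , (a , b) , (_ , ev , _ , ¬esv) , eq) k s
    with i + k ≤? a
  ... | yes r≤a = InShape-≤ ev (proj₁ s) (s≤s z≤n) r≤a (s≤s c≤b)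
    where
    c≤b : j + k ≤ b
    c≤b = +-cancelʳ-≤ i (j + k) b (≤-trans (≤-reflexive
      (solve 3 (λ j k i → (j :+ k) :+ i := j :+ (i :+ k)) refl j k i))
      (≤-trans (+-monoʳ-≤ j r≤a) (≤-reflexive (sym (content-≡ (a , b) (i , j) eq)))))
      where open +-*-Solver
  ... | no r≰a = contradiction
    (InShape-≤ s (s≤s z≤n) (s≤s z≤n) (≰⇒> r≰a) b<c) ¬esv
    where
    b<c : b < j + k
    b<c = +-cancelʳ-< i b (j + k) (<-≤-trans
      (≤-trans (s≤s (≤-reflexive (content-≡ (a , b) (i , j) eq))) (+-monoʳ-< j (≰⇒> r≰a)))
      (≤-reflexive (solve 3 (λ j k i → j :+ (i :+ k) := (j :+ k) :+ i) refl j k i)))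
      where open +-*-Solver

  -- A walk down the column ends at an outer corner, since east neighbours stay outside λ further
  -- south. `fuel` bounds the rows left: below row `length lam` all rows are empty.
  outerCorner-below : ∀ fuel u → length lam ≤ fuel + row u → S u → ¬ S (east u) →
    Σ Cell λ w → IsOuterCorner lam w × row u ≤ row w × col w ≡ col u
  outerCorner-below fuel u l s ¬e with InShape? (south u)
  ... | no ¬s = u , (s , ¬e , ¬s) , ≤-refl , refl
  outerCorner-below zero u l s ¬e | yes (_ , q , c) =
    contradiction (≤-trans q (≤-trans c (≤-reflexive (rowLen≡0 lam (s≤s l))))) λ ()
  outerCorner-below (suc fuel) u l s ¬e | yes s′
    with outerCorner-below fuel (south u) (≤-trans l (≤-reflexive (sym (+-suc fuel (row u))))) s′
           (λ e → ¬e (InShape-≤ e (proj₁ s) (s≤s z≤n) (n≤1+n _) ≤-refl))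
  ... | w , oc , r , c = w , oc , ≤-trans (n≤1+n _) r , c

  -- If the cell r of the diagonal had no east neighbour in λ, its column would contain, at or below
  -- r, an outer corner w, with c(w) ≤ c(u). This refutes the first case of `InA`; in the second it
  -- leaves only c(w) ≤ c(v) < c(u) for the inner corner v = `(a , b)`.
  InA⇒eastExit : ∀ {u} → InA lam u → EastExit u
  InA⇒eastExit {u@(i , j)} (_ , alt) k s = decidable-stable (InShape? _) (absurd alt)
    where
    r = shift k u
    open +-*-Solver

    below : ¬ S (east r) →
            Σ Cell λ w → IsOuterCorner lam w × i + k ≤ row w × col w ≡ j + k
    below = outerCorner-below (length lam) r (m≤m+n _ _) s

    outer≤ : ∀ w → i + k ≤ row w → col w ≡ j + k → ¬ content u ℤ.< content w
    outer≤ (a , b) r≤a refl lt = <⇒≱ (content-< u (a , b) lt) (≤-trans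
      (≤-reflexive (solve 3 (λ j k i → (j :+ k) :+ i := j :+ (i :+ k)) refl j k i))
      (+-monoʳ-≤ j r≤a))

    absurd : _ → ¬ ¬ S (east r)
    absurd (inj₁ small) ¬e with below ¬e
    ... | w , oc , r≤w , c = outer≤ w r≤w c (small _ (w , oc , refl))
    absurd (inj₂ (_ , ((a , b) , (_ , ev , sv , ¬esv) , refl) , v<u , next)) ¬e with below ¬e
    ... | w@(x , .(j + k)) , oc@(sw , _) , r≤w , refl with b + x <? (j + k) + a
    ...   | yes v<w = outer≤ w r≤w refl (next _ (w , oc , refl) (<-content (a , b) w v<w))
    ...   | no v≮w with b <? j + k
    -- Here w lies strictly south-east of the inner corner, whose south-east neighbour would then be
    -- in λ.
    ...     | yes b<c = ¬esv (InShape-≤ sw (s≤s z≤n) (s≤s z≤n) a<x b<c)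
      where
      a<x : a < x
      a<x = +-cancelˡ-< b a x (<-≤-trans (+-monoˡ-< a b<c) (≮⇒≥ v≮w))
    -- Here c(v) < c(u) forces r into the rows up to a, so its east neighbour lies weakly north-west
    -- of that of `(a , b)`.
    ...     | no b≮c = ¬e (InShape-≤ ev (proj₁ s) (s≤s z≤n) r≤a (s≤s (≮⇒≥ b≮c)))
      where
      r≤a : i + k ≤ a
      r≤a = +-cancelˡ-≤ j (i + k) a (≤-trans
        (≤-reflexive (solve 3 (λ j k i → j :+ (i :+ k) := (j :+ k) :+ i) refl j k i))
        (≤-trans (+-monoˡ-≤ i (≮⇒≥ b≮c)) (<⇒≤ (content-< (a , b) u v<u))))


  -- Trails: insertion paths built from the tail

  -- Read from the rim inwards, the values on a diagonal form a partition; v marks a row that can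
  -- take another box.
  Addable : RPP → Cell → Set
  Addable π v = S (east (south v)) → π v < π (east (south v))

  -- A path under construction; a constructor records from which side the path enters its
  -- previous first cell, together with the reason why the insertion rule chose that side.
  data Trail (π : RPP) : Cell → List Cell → Set where
    stop : ∀ {v} → S v → ¬ S (east v) → Trail π v []
    fromWest : ∀ {i j us} → Trail π (i , suc j) us → S (i , j) →
      (S (suc i , suc j) → π (i , suc j) < π (suc i , suc j)) →
      (EastExit (i , j) → π (i , suc j) ≡ π (i , j)) →
      Trail π (i , j) ((i , suc j) ∷ us)
    fromSouth : ∀ {i j us} → Trail π (i , j) us → S (suc i , j) →
      π (i , j) ≡ π (suc i , j) → ¬ EastExit (suc i , j) →
      Trail π (suc i , j) ((i , j) ∷ us)

  module _ {π : RPP} where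

    trail-head : ∀ {v us} → Trail π v us → S v
    trail-head (stop s _) = s
    trail-head (fromWest _ s _ _) = s
    trail-head (fromSouth _ s _ _) = s

    trail-inShape : ∀ {v us} → Trail π v us → All S (v ∷ us)
    trail-inShape (stop s _) = s ∷ []
    trail-inShape (fromWest t s _ _) = s ∷ trail-inShape t
    trail-inShape (fromSouth t s _ _) = s ∷ trail-inShape t

    trail-linked : ∀ {v us} → Trail π v us → Linked NEStep (v ∷ us)
    trail-linked (stop _ _) = [-]
    trail-linked (fromWest t _ _ _) = inj₂ refl ∷ trail-linked t
    trail-linked (fromSouth t _ _ _) = inj₁ refl ∷ trail-linked t

    trail-⊑ : ∀ {v us p} → Trail π v us → p ∈ v ∷ us → v ⊑ p
    trail-⊑ _ (here refl) = ⊑-refl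
    trail-⊑ (fromWest t _ _ _) (there p∈) = ⊑-trans (≤-refl , n≤1+n _) (trail-⊑ t p∈)
    trail-⊑ (fromSouth t _ _ _) (there p∈) = ⊑-trans (n≤1+n _ , ≤-refl) (trail-⊑ t p∈)

    trail-chain : ∀ {v us p q} → Trail π v us → p ∈ v ∷ us → q ∈ v ∷ us → p ⊑ q ⊎ q ⊑ p
    trail-chain t (here refl) q∈ = inj₁ (trail-⊑ t q∈)
    trail-chain t (there p∈) (here refl) = inj₂ (trail-⊑ t (there p∈))
    trail-chain (fromWest t _ _ _) (there p∈) (there q∈) = trail-chain t p∈ q∈
    trail-chain (fromSouth t _ _ _) (there p∈) (there q∈) = trail-chain t p∈ q∈

    -- The two neighbours are incomparable for `⊑`, whereas the cells of a path form a chain.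
    trail-¬north-east : ∀ {v us p} → Trail π v us → north p ∈ v ∷ us → ¬ east p ∈ v ∷ us
    trail-¬north-east {p = i , j} t n∈ e∈ with trail-chain t n∈ e∈
    -- `north` fixes the cells of row 0, so here the positivity of rows in λ has to decide.
    trail-¬north-east {p = zero , j} t n∈ e∈ | inj₁ _ =
      contradiction (proj₁ (All.lookup (trail-inShape t) e∈)) λ ()
    trail-¬north-east {p = suc i , j} t n∈ e∈ | inj₁ (r , _) = 1+n≰n r
    ... | inj₂ (_ , c) = 1+n≰n c

    data Successor (Q : List Cell) (p : Cell) : Set where
      none : ¬ S (east p) → (∀ {q} → q ∈ Q → q ⊑ p) → Successor Q p
      eastward : east p ∈ Q → (EastExit p → π (east p) ≡ π p) → Successor Q p
      northward : ∀ {q} → p ≡ south q → q ∈ Q → π q ≡ π p → ¬ EastExit p → Successor Q p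

    successor-there : ∀ {u Q p} → u ⊑ p → Successor Q p → Successor (u ∷ Q) p
    successor-there u⊑ (none e last) = none e λ { (here refl) → u⊑ ; (there q∈) → last q∈ }
    successor-there _ (eastward e∈ eq) = eastward (there e∈) eq
    successor-there _ (northward e q∈ eq h) = northward e (there q∈) eq h

    successor : ∀ {v us p} → Trail π v us → p ∈ v ∷ us → Successor (v ∷ us) p
    successor (stop _ ¬e) (here refl) = none ¬e λ { (here refl) → ⊑-refl }
    successor (fromWest _ _ _ eq) (here refl) = eastward (there (here refl)) eq
    successor t₀@(fromWest t _ _ _) (there p∈) =
      successor-there (trail-⊑ t₀ (there p∈)) (successor t p∈)
    successor (fromSouth _ _ eq h) (here refl) = northward refl (there (here refl)) eq h
    successor t₀@(fromSouth t _ _ _) (there p∈) =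
      successor-there (trail-⊑ t₀ (there p∈)) (successor t p∈)

    data Predecessor (Q : List Cell) (p : Cell) : Set where
      western : ∀ {q} → p ≡ east q → q ∈ Q → (S (south p) → π p < π (south p)) →
                Predecessor Q p
      southern : south p ∈ Q → π p ≡ π (south p) → ¬ EastExit (south p) → Predecessor Q p

    predecessor-there : ∀ {u Q p} → Predecessor Q p → Predecessor (u ∷ Q) p
    predecessor-there (western e q∈ lt) = western e (there q∈) lt
    predecessor-there (southern s∈ eq h) = southern (there s∈) eq h

    predecessor : ∀ {v us p} → Trail π v us → p ∈ v ∷ us → p ≡ v ⊎ Predecessor (v ∷ us) p
    predecessor t (here refl) = inj₁ refl
    predecessor (fromWest t _ lt _) (there p∈) with predecessor t p∈
    ... | inj₁ refl = inj₂ (western refl (here refl) lt)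
    ... | inj₂ w = inj₂ (predecessor-there w)
    predecessor (fromSouth t _ eq h) (there p∈) with predecessor t p∈
    ... | inj₁ refl = inj₂ (southern (here refl) eq h)
    ... | inj₂ w = inj₂ (predecessor-there w)

    -- Every step raises the content by one, so no diagonal between the ends is skipped.
    trail-cover : ∀ {α m v us} → Trail π v us → AtOffset α m v → ∀ k → k ≤ length us →
                  ∃ λ p → p ∈ v ∷ us × AtOffset α (k + m) p
    trail-cover {v = v} t d zero _ = v , here refl , d
    trail-cover {α} {m} {i , j} (fromWest t _ _ _) d (suc k) (s≤s k≤)
      with trail-cover t (offset-east {α} {m} (i , j) d) k k≤
    ... | p , p∈ , e = p , there p∈ , subst (λ n → AtOffset α n p) (+-suc k m) e
    trail-cover {α} {m} {suc i , j} (fromSouth t _ _ _) d (suc k) (s≤s k≤)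
      with trail-cover t (offset-north {α} {m} (i , j) d) k k≤
    ... | p , p∈ , e = p , there p∈ , subst (λ n → AtOffset α n p) (+-suc k m) e

    module _ (rpp : IsRPP lam π) where

      -- At the tail nothing of λ lies south-east. A cell added on the west inherits the strict rise
      -- recorded at its successor; a cell added on the south has the same value as its successor,
      -- whose addability carries over.
      trail-head-addable : ∀ {v us} → Trail π v us → Addable π v
      trail-head-addable (stop s ¬e) es = contradiction
        (InShape-≤ es (proj₁ s) (s≤s z≤n) (n≤1+n _) ≤-refl) ¬e
      trail-head-addable (fromWest t s lt _) es =
        ≤-<-trans (proj₁ (rpp _ s) (InShape-≤ es (proj₁ s) (s≤s z≤n) (n≤1+n _) ≤-refl))
                  (lt es)
      trail-head-addable {v = suc i , j} (fromSouth t s eq _) es =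
        subst (_< π (suc (suc i) , suc j)) eq
          (<-≤-trans (trail-head-addable t es′) (proj₂ (rpp _ es′) es))
        where
        es′ : S (suc i , suc j)
        es′ = InShape-≤ es (s≤s z≤n) (s≤s z≤n) (n≤1+n _) ≤-refl

      trail-addable : ∀ {v us p} → Trail π v us → p ∈ v ∷ us → Addable π p
      trail-addable t (here refl) = trail-head-addable t
      trail-addable (fromWest t _ _ _) (there p∈) = trail-addable t p∈
      trail-addable (fromSouth t _ _ _) (there p∈) = trail-addable t p∈

  -- Invariants between insertions

  -- What the insertion of a hook from α to ω requires. G is a region that the path cannot
  -- leave: all cells for the first hook of a column, the cells weakly south-east of the
  -- preceding path otherwise. G-head is needed since no path cell lies below the head.
  record Ready (π : RPP) (α ω : Cell) : Set₁ where
    field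
      isRPP : IsRPP lam π
      equal : ∀ u → S u → Beyond α u → EastExit u → π (east u) ≡ π u
      vanish : ∀ u → S u → Beyond α u → S (shift (col α) u) → π u ≡ 0
      G : Cell → Set
      G-tail : G ω
      G-west : ∀ {n i j} → G (i , suc j) → AtOffset α (suc n) (i , suc j) →
               (S (suc i , suc j) → π (i , suc j) < π (suc i , suc j)) → G (i , j)
      G-south : ∀ {n v} → G v → AtOffset α (suc n) v → S (south v) → π v ≡ π (south v) →
                G (south v)
      G-wall : ∀ {n i} → G (i , 1) → AtOffset α (suc n) (i , 1) → S (suc i , 1) →
               π (suc i , 1) ≤ π (i , 1)
      G-bound : ∀ {n v} → G v → S v → AtOffset α n v → Addable π v → ¬ S (shift (col α) v)
      G-head : ∀ {v} → G v → S v → AtOffset α 0 v → ∀ k → S (east (south (shift k v))) →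
               π (east (south (shift k v))) ≤ π (south (shift k v))

  -- What an insertion guarantees, Q being the list of cells of the insertion path.
  -- Q-head concerns the diagonal just below c(α): it is still equal to the diagonal of α
  -- strictly south-east of the head, which keeps the next path of the same column admissible.
  record Status (π : RPP) (α ω : Cell) : Set where
    field
      isRPP : IsRPP lam π
      equal : ∀ u → S u → Beyond α u → EastExit u → π (east u) ≡ π u
      vanish : ∀ u → S u → Beyond α u → S (shift (col α) u) → π u ≡ 0
      Q : List Cell
      Q-inShape : ∀ {p} → p ∈ Q → S p
      Q-bound : ∀ {p} → p ∈ Q → ¬ S (shift (col α) p)
      Q-pred : ∀ {n p} → p ∈ Q → AtOffset α (suc n) p →
               (∃ λ q → p ≡ east q × q ∈ Q) ⊎ (south p ∈ Q × π p ≡ π (south p))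
      Q-cover : ∀ {m n} → AtOffset α n ω → m ≤ n → ∃ λ p → p ∈ Q × AtOffset α m p
      Q-head : ∀ {p} → p ∈ Q → AtOffset α 0 p → ∀ k → S (east (south (shift k p))) →
               π (east (south (shift k p))) ≤ π (south (shift k p))

  record Hook (α ω : Cell) (n : ℕ) : Set where
    field
      head-in : S α
      head-bottom : ¬ S (south α)
      tail-in : S ω
      tail-right : ¬ S (east ω)
      hook-length : AtOffset α n ω

  path-offset : ∀ {v us} → All S (v ∷ us) → Linked NEStep (v ∷ us) →
                S (lastCell v us) × AtOffset v (length us) (lastCell v us)
  path-offset (s ∷ []) _ = s , refl
  path-offset {us = w ∷ us} (_ ∷ ss) (st ∷ l) with path-offset ss l
  path-offset {v = suc i , j} {us = _ ∷ us} (_ ∷ ss) (inj₁ refl ∷ l) | s , d =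
    s , trans (+-suc _ i) (cong suc d)
  path-offset {v = i , j} {us = _ ∷ us} (_ ∷ ss) (inj₂ refl ∷ l) | s , d =
    s , trans d (cong (_+ row (lastCell (i , suc j) us)) (+-suc (length us) j))
  path-offset {v = zero , j} ((() , _) ∷ _) (inj₁ refl ∷ l) | _

  rimHook⇒hook : ∀ {h} → IsRimHook lam h → Hook (head h) (tail h) (len h)
  rimHook⇒hook ((ss , l) , b , r , _) = record
    { head-in = All.head ss
    ; head-bottom = b
    ; tail-in = proj₁ (path-offset ss l)
    ; tail-right = r
    ; hook-length = proj₂ (path-offset ss l)
    }

  -- For v strictly above α, the south-east neighbour of v is weakly north-west of α. From α on,
  -- `south v` would be weakly south-east of `south α`, which is outside λ.
  head-diagonal : ∀ {α ω n} → Hook α ω n → ∀ v → AtOffset α 0 v → S (south v) →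
                  S (east (south v))
  head-diagonal {a , b} hook (i , j) d s with suc i ≤? a
  ... | yes i<a = InShape-≤ (Hook.head-in hook) (s≤s z≤n) (s≤s z≤n) i<a
    (+-cancelʳ-< i j b (<-≤-trans (+-monoʳ-< j i<a) (≤-reflexive d)))
  ... | no i≮a = contradiction
    (InShape-≤ s (s≤s z≤n) (proj₁ (proj₂ (Hook.head-in hook))) (≰⇒> i≮a) b≤j)
    (Hook.head-bottom hook)
    where
    b≤j : b ≤ j
    b≤j = +-cancelʳ-≤ i b j
      (≤-trans (≤-reflexive (sym d)) (+-monoʳ-≤ j (≤-pred (≰⇒> i≮a))))

  -- Inserting one hook

  module _ {π α ω n} (ready : Ready π α ω) (hook : Hook α ω n) where
    open Ready ready
    open Hook hook

    private
      Bounded : Cell → Set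
      Bounded p = ¬ S (shift (col α) p)

    record Extension (n : ℕ) (v : Cell) (us : List Cell) : Set where
      field
        {first} : Cell
        {rest} : List Cell
        at-start : AtOffset α 0 first
        good : G first
        trail : Trail π first rest
        bounded : All Bounded (first ∷ rest)
        same-tail : lastCell first rest ≡ lastCell v us
        length-rest : length rest ≡ n + length us

    extend : ∀ n v us → AtOffset α n v → G v → Trail π v us → All Bounded (v ∷ us) →
             Extension n v us
    extend zero v us d g t bs = record
      { at-start = d ; good = g ; trail = t ; bounded = bs
      ; same-tail = refl ; length-rest = refl }
    extend (suc n) v@(i , j) us d g t bs
      with InShape? (south v) ×-dec (π v ≟ π (south v))
    ... | yes (s , eq) = record
      { at-start = at-start ; good = good ; trail = trail ; bounded = bounded
      ; same-tail = same-tail ; length-rest = trans length-rest (+-suc n (length us)) }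
      where
      d′ : AtOffset α n (south v)
      d′ = offset-south {α} {n} v d
      -- An east exit would, by `equal`, make π agree on v, `south v` and the south-east neighbour
      -- of v, against the addability of v.
      ¬exit : ¬ EastExit (south v)
      ¬exit h = <⇒≢ (trail-head-addable isRPP t (eastExit-here h s))
        (trans eq (sym (equal (south v) s (beyond {α} {n} (south v) d′) h)))
      t′ : Trail π (south v) (v ∷ us)
      t′ = fromSouth t s eq ¬exit
      g′ : G (south v)
      g′ = G-south g d s eq
      open Extension (extend n (south v) (v ∷ us) d′ g′ t′
        (G-bound g′ s d′ (trail-head-addable isRPP t′) ∷ bs))
    ... | no ¬sv = west-step j refl
      where
      lt : S (south v) → π v < π (south v)
      lt s = ≤∧≢⇒< (proj₂ (isRPP v (trail-head t)) s) λ eq → ¬sv (s , eq)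
      west-step : ∀ j′ → j ≡ j′ → Extension (suc n) v us
      west-step 0 refl = contradiction (proj₁ (proj₂ (trail-head t))) λ ()
      -- A step west would leave λ. As c(v) > c(α), v lies above the row of α, so the cell below v
      -- is in λ and `G-wall` contradicts the strict rise `lt`.
      west-step 1 refl = contradiction (G-wall g d below) (<⇒≱ (lt below))
        where
        i<a : i < row α
        i<a = ≤-trans (+-monoˡ-≤ i (≤-trans (proj₁ (proj₂ head-in)) (m≤n+m (col α) n)))
                      (≤-reflexive (sym (suc-injective d)))
        below : S (suc i , 1)
        below = InShape-≤ head-in (s≤s z≤n) (s≤s z≤n) i<a (proj₁ (proj₂ head-in))
      west-step (suc (suc j″)) refl = record
        { at-start = at-start ; good = good ; trail = trail ; bounded = bounded
        ; same-tail = same-tail ; length-rest = trans length-rest (+-suc n (length us)) }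
        where
        w : Cell
        w = i , suc j″
        d′ : AtOffset α n w
        d′ = offset-west {α} {n} {i} {suc j″} d
        s : S w
        s = InShape-west (trail-head t)
        t′ : Trail π w (v ∷ us)
        t′ = fromWest t s lt (equal w s (beyond {α} {n} w d′))
        g′ : G w
        g′ = G-west g d lt
        open Extension (extend n w (v ∷ us) d′ g′ t′
          (G-bound g′ s d′ (trail-head-addable isRPP t′) ∷ bs))

    insertion : Extension n ω []
    insertion = extend n ω [] hook-length G-tail start
      (G-bound G-tail tail-in hook-length (trail-head-addable isRPP start) ∷ [])
      where
      start : Trail π ω []
      start = stop tail-in tail-right

    open Extension insertion

    private
      P : Path
      P = first , rest

      π′ : RPP
      π′ = π +P P

      inShape : ∀ {p} → p ∈ cells P → S p
      inShape = All.lookup (trail-inShape trail)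

      compatible-east : ∀ {u} → u ∈ cells P → EastExit u → east u ∈ cells P × π (east u) ≡ π u
      compatible-east u∈ h with successor trail u∈
      ... | none ¬e _ = contradiction (eastExit-here h (inShape u∈)) ¬e
      ... | eastward e∈ eq = e∈ , eq h
      ... | northward _ _ _ ¬h = contradiction h ¬h

      compatible-north : ∀ u → u ∈ cells P → north u ∈ cells P → π (north u) ≡ π u
      compatible-north u u∈ n∈ with successor trail u∈
      ... | northward refl _ eq _ = eq
      ... | eastward e∈ _ = contradiction e∈ (trail-¬north-east trail n∈)
      ... | none _ last = contradiction (proj₁ (last n∈)) (pred-< (proj₁ (inShape u∈)))
        where
        pred-< : ∀ {m} → 1 ≤ m → ¬ (m ≤ pred m)
        pred-< {suc _} _ = 1+n≰n

      addable : ∀ {p} → p ∈ cells P → Addable π p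
      addable = trail-addable isRPP trail

      head-offset : ∀ {n} → ¬ AtOffset α (suc n) first
      head-offset d = contradiction (offset-unique {α} first at-start d) λ ()

      predecessor′ : ∀ {n p} → p ∈ cells P → AtOffset α (suc n) p → Predecessor {π} (cells P) p
      predecessor′ p∈ d with predecessor trail p∈
      ... | inj₁ refl = contradiction d head-offset
      ... | inj₂ w = w

      off : ∀ {u} → u ∉ cells P → ∀ v → π u ≤ π v → π′ u ≤ π′ v
      off u∉ v le = ≤-trans (≤-reflexive (+P-∉ π P u∉)) (≤-trans le (+P-≥ π P v))

      on-strict : ∀ {u} → u ∈ cells P → ∀ v → π u < π v → π′ u ≤ π′ v
      on-strict u∈ v lt = ≤-trans (≤-reflexive (+P-∈ π P u∈)) (≤-trans lt (+P-≥ π P v))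

      on-both : ∀ {u v} → u ∈ cells P → v ∈ cells P → π u ≤ π v → π′ u ≤ π′ v
      on-both u∈ v∈ le = subst₂ _≤_ (sym (+P-∈ π P u∈)) (sym (+P-∈ π P v∈)) (s≤s le)

      -- If the path enters u from the west, the insertion rule recorded the strict rise. At the
      -- head, addability gives a strict rise to the south-east neighbour, whose value `G-head`
      -- bounds by that of `south u`.
      on-south : ∀ {u} → u ∈ cells P → S (south u) → south u ∉ cells P → π u < π (south u)
      on-south {u} u∈ s s∉ with predecessor trail u∈
      ... | inj₂ (western _ _ lt) = lt s
      ... | inj₂ (southern s∈ _ _) = contradiction s∈ s∉
      ... | inj₁ refl = <-≤-trans (addable u∈ es) head-≤
        where
        es : S (east (south first))
        es = head-diagonal hook first at-start s
        head-≤ : π (east (south first)) ≤ π (south first)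
        head-≤ = subst (λ v → π (east (south v)) ≤ π (south v)) (shift-0 first)
          (G-head good (inShape u∈) at-start 0
            (subst (S ∘ east ∘ south) (sym (shift-0 first)) es))

      isRPP′ : IsRPP lam π′
      isRPP′ u s with u ∈? cells P
      ... | no u∉ = (λ e → off u∉ _ (proj₁ (isRPP u s) e)) , (λ e → off u∉ _ (proj₂ (isRPP u s) e))
      ... | yes u∈ = to-east , to-south
        where
        to-east : S (east u) → π′ u ≤ π′ (east u)
        to-east e with successor trail u∈
        ... | none ¬e _ = contradiction e ¬e
        ... | eastward e∈ _ = on-both u∈ e∈ (proj₁ (isRPP u s) e)
        -- `east u` is the south-east neighbour of the next path cell, so the addability of that
        -- cell supplies the strict rise.
        ... | northward refl q∈ eq _ = on-strict u∈ _ (subst (_< π (east u)) eq (addable q∈ e))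
        to-south : S (south u) → π′ u ≤ π′ (south u)
        to-south e with south u ∈? cells P
        ... | yes s∈ = on-both u∈ s∈ (proj₂ (isRPP u s) e)
        ... | no s∉ = on-strict u∈ _ (on-south u∈ e s∉)

      -- Both values rise or neither does: compatibility takes the path from u to `east u`, and
      -- entering `east u` from the south would need a diagonal without east exit.
      equal′ : ∀ u → S u → Beyond α u → EastExit u → π′ (east u) ≡ π′ u
      equal′ u@(i , j) s b h with offset u b | u ∈? cells P
      ... | _ | yes u∈ with compatible-east u∈ h
      ...   | e∈ , eq = trans (+P-∈ π P e∈) (trans (cong suc eq) (sym (+P-∈ π P u∈)))
      equal′ u@(i , j) s b h | m , d | no u∉ =
        trans (+P-∉ π P e∉) (trans (equal u s b h) (sym (+P-∉ π P u∉)))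
        where
        e∉ : east u ∉ cells P
        e∉ e∈ with predecessor′ e∈ (offset-east {α} {m} u d)
        ... | western refl u∈ _ = u∉ u∈
        ... | southern _ _ ¬h = ¬h (eastExit-es h)

      -- `bounded` keeps the path among the `col α` outermost cells of each diagonal, so the cells
      -- further in are untouched.
      vanish′ : ∀ u → S u → Beyond α u → S (shift (col α) u) → π′ u ≡ 0
      vanish′ u s b sh =
        trans (+P-∉ π P λ u∈ → All.lookup bounded u∈ sh) (vanish u s b sh)

      -- Both cells of a southward tie rise by one, so the tie survives to steer the next path.
      pred′ : ∀ {n p} → p ∈ cells P → AtOffset α (suc n) p →
              (∃ λ q → p ≡ east q × q ∈ cells P) ⊎
              (south p ∈ cells P × π′ p ≡ π′ (south p))
      pred′ p∈ d with predecessor′ p∈ d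
      ... | western eq q∈ _ = inj₁ (_ , eq , q∈)
      ... | southern s∈ eq _ =
        inj₂ (s∈ , trans (+P-∈ π P p∈) (trans (cong suc eq) (sym (+P-∈ π P s∈))))

      cover′ : ∀ {m n} → AtOffset α n ω → m ≤ n → ∃ λ p → p ∈ cells P × AtOffset α m p
      cover′ {m} d m≤n with offset-unique {α} ω d hook-length
      ... | refl with trail-cover {α = α} trail at-start m
                        (≤-trans m≤n (≤-reflexive (sym (trans length-rest (+-identityʳ _)))))
      ...   | p , p∈ , e = p , p∈ , subst (λ k → AtOffset α k p) (+-identityʳ m) e

      head-unique : ∀ {p} → p ∈ cells P → AtOffset α 0 p → first ≡ p
      head-unique {p} p∈ d with trail-⊑ trail p∈
      ... | r , c with same-diagonal {α} p first d at-start r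
      ...   | k , eq = trans eq (shift-col-≤ k p (≤-trans (≤-reflexive (cong col (sym eq))) c))

      -- The cell on the left lies south of the head, hence off the path, and the value on the right
      -- cannot fall.
      head′ : ∀ {p} → p ∈ cells P → AtOffset α 0 p → ∀ k → S (east (south (shift k p))) →
              π′ (east (south (shift k p))) ≤ π′ (south (shift k p))
      head′ {p} p∈ d k es with head-unique p∈ d
      ... | refl = off es∉ _ (G-head good (inShape p∈) d k es)
        where
        es∉ : east (south (shift k p)) ∉ cells P
        es∉ q∈ = 1+n≰n (m+n≤o⇒m≤o (suc (row p)) (proj₁ (trail-⊑ trail q∈)))

    insertionPath : ∀ h → tail h ≡ ω → len h ≡ n → InsertionPath lam h π P
    insertionPath _ refl refl =
      (trail-inShape trail , trail-linked trail) ,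
      ((λ u u∈ → λ { (inj₁ a) → compatible-east u∈ (InI⇒eastExit a)
                   ; (inj₂ a) → compatible-east u∈ (InA⇒eastExit a) })
      , compatible-north) ,
      same-tail , trans length-rest (+-identityʳ _) , isRPP′

    status : Status π′ α ω
    status = record
      { isRPP = isRPP′ ; equal = equal′ ; vanish = vanish′ ; Q = cells P
      ; Q-inShape = inShape ; Q-bound = All.lookup bounded ; Q-pred = pred′
      ; Q-cover = cover′ ; Q-head = head′ }

  -- From one insertion to the next

  ready-zero : ∀ {α ω n} → Hook α ω n → Ready zeroRPP α ω
  ready-zero {α} hook = record
    { isRPP = λ _ _ → (λ _ → z≤n) , (λ _ → z≤n)
    ; equal = λ _ _ _ _ → refl
    ; vanish = λ _ _ _ _ → refl
    ; G = λ _ → ⊤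
    ; G-tail = tt
    ; G-west = λ _ _ _ → tt
    ; G-south = λ _ _ _ _ → tt
    ; G-wall = λ _ _ _ → z≤n
    -- With all values zero only the last cell of a diagonal is addable, and already one step beyond
    -- it leaves λ.
    ; G-bound = λ {_} {v} _ s _ add sh → n≮0 (add (es s sh))
    ; G-head = λ _ _ _ _ _ → z≤n
    }
    where
    es : ∀ {v} → S v → S (shift (col α) v) → S (east (south v))
    es {v} s sh = subst S (trans (shift-suc 0 v) (shift-0 _))
      (InShape-unshift (col α) s (proj₁ (proj₂ (Hook.head-in hook))) sh)

  module _ {π α ω n α′ ω′ n′} (status : Status π α ω) (hook : Hook α ω n)
           (hook′ : Hook α′ ω′ n′) where
    open Status status
    private
      module H = Hook hook
      module H′ = Hook hook′
      a b a′ b′ : ℕ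
      a = row α
      b = col α
      a′ = row α′
      b′ = col α′

    -- Here α′ lies strictly east and weakly north of α, so the old status covers every diagonal
    -- from c(α′) on and also the one just below. At most `b < b′` outermost cells being nonzero
    -- confines the new path, so `G` can be everything.
    ready-new-column : b < b′ → Ready π α′ ω′
    ready-new-column b<b′ = record
      { isRPP = isRPP
      ; equal = λ u s d → equal u s (weaken u d)
      ; vanish = λ u s d sh → vanish u s (weaken u d) (InShape-unshift b′ s (<⇒≤ b<b′) sh)
      ; G = λ _ → ⊤
      ; G-tail = tt
      ; G-west = λ _ _ _ → tt
      ; G-south = λ _ _ _ _ → tt
      ; G-wall = wall
      ; G-bound = λ {_} {v} _ s d add → bound v s d add
      ; G-head = λ {v} _ s d k es → head-≤ v s d k es
      }
      where
      a′≤a : a′ ≤ a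
      a′≤a = ≮⇒≥ λ a<a′ → H.head-bottom
        (InShape-≤ H′.head-in (s≤s z≤n) (proj₁ (proj₂ H.head-in)) a<a′ (<⇒≤ b<b′))

      weaken : ∀ u → Beyond α′ u → Beyond α u
      weaken u d = ≤-trans (+-monoˡ-≤ (row u) (<⇒≤ b<b′)) (≤-trans d (+-monoʳ-≤ (col u) a′≤a))

      weaken-south : ∀ {n} u → AtOffset α′ n u → Beyond α (south u)
      weaken-south {n} u d = ≤-trans (≤-reflexive (+-suc b (row u)))
        (≤-trans (+-monoˡ-≤ (row u) b<b′)
          (≤-trans (beyond {α′} {n} u d) (+-monoʳ-≤ (col u) a′≤a)))

      wall : ∀ {n i} → ⊤ → AtOffset α′ (suc n) (i , 1) → S (suc i , 1) → π (suc i , 1) ≤ π (i , 1)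
      wall {n} {i} _ d s = ≤-trans
        (≤-reflexive (vanish (suc i , 1) s (weaken-south {suc n} (i , 1) d)
          (InShape-≤ H′.head-in (s≤s z≤n) (s≤s z≤n) row≤ b<b′))) z≤n
        where
        -- Shifted by b, the cell below the wall cell is still weakly north-west of α′, so `vanish`
        -- applies to it.
        row≤ : suc i + b ≤ a′
        row≤ = ≤-trans (≤-reflexive (sym (+-suc i b))) (≤-trans (+-monoʳ-≤ i b<b′)
          (≤-trans (≤-reflexive (+-comm i b′)) (≤-trans (+-monoˡ-≤ i (m≤n+m b′ n))
            (≤-reflexive (sym (suc-injective d))))))

      -- If `shift b′ v` were in λ, the south-east neighbour of v could be shifted b times and would
      -- hold 0, so v would not be addable.
      bound : ∀ {n} v → S v → AtOffset α′ n v → Addable π v → ¬ S (shift b′ v)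
      bound {n} v s d add sh = contradiction
        (vanish (east (south v)) es (≤-trans (weaken-south {n} v d) (n≤1+n _))
          (subst S (shift-suc b v) (InShape-unshift b′ s b<b′ sh)))
        (>⇒≢ (≤-<-trans z≤n (add es)))
        where
        es : S (east (south v))
        es = subst S (trans (shift-suc 0 v) (shift-0 _))
          (InShape-unshift b′ s (≤-trans (s≤s z≤n) b<b′) sh)

      -- The diagonal just below c(α′) has east exits by `head-diagonal` and content at least c(α),
      -- so the old `equal` applies.
      head-≤ : ∀ v → S v → AtOffset α′ 0 v → ∀ k → S (east (south (shift k v))) →
               π (east (south (shift k v))) ≤ π (south (shift k v))
      head-≤ v s d k es = ≤-reflexive (equal w sw (weaken-south {0} (shift k v) d′) exit)
        where
        w : Cell
        w = south (shift k v)
        d′ : AtOffset α′ 0 (shift k v)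
        d′ = offset-shift {α′} {0} k v d
        sw : S w
        sw = InShape-≤ es (s≤s z≤n) (≤-trans (proj₁ (proj₂ s)) (m≤m+n (col v) k)) ≤-refl (n≤1+n _)
        exit : EastExit w
        exit l = head-diagonal hook′ (shift l (shift k v)) (offset-shift {α′} {0} l (shift k v) d′)

    -- The new path is trapped weakly south-east of the old one, so the bound and the comparison at
    -- the head are inherited from the old path.
    ready-same-column : α ≡ α′ → row ω ≤ row ω′ → Ready π α′ ω′
    ready-same-column refl r≤r′ = record
      { isRPP = isRPP
      ; equal = equal
      ; vanish = vanish
      ; G = Below
      ; G-tail = below-tail
      ; G-west = below-west
      ; G-south = below-south
      ; G-wall = wall
      ; G-bound = λ { (p , p∈ , k , refl) _ _ _ sh → Q-bound p∈ (unshift-bound k p p∈ sh) }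
      ; G-head = λ { (p , p∈ , k , refl) _ d l es →
          subst (λ v → π (east (south v)) ≤ π (south v)) (sym (shift-shift k l p))
            (Q-head p∈ (offset-unshift {α} {0} k p d) (k + l)
              (subst (S ∘ east ∘ south) (shift-shift k l p) es)) }
      }
      where
      Below : Cell → Set
      Below v = ∃ λ p → p ∈ Q × ∃ λ k → v ≡ shift k p

      c′≤c : col ω′ ≤ col ω
      c′≤c = ≮⇒≥ λ c<c′ → H.tail-right
        (InShape-≤ H′.tail-in (proj₁ H.tail-in) (s≤s z≤n) r≤r′ c<c′)

      n′≤n : n′ ≤ n
      n′≤n = +-cancelʳ-≤ b n′ n (+-cancelʳ-≤ (row ω′) (n′ + b) (n + b)
        (≤-trans (≤-reflexive (sym H′.hook-length)) (≤-trans (+-monoˡ-≤ a c′≤c)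
          (≤-trans (≤-reflexive H.hook-length) (+-monoʳ-≤ (n + b) r≤r′)))))

      -- The old path is at least as long, so it meets the diagonal of ω′. Meeting it beyond ω′
      -- would put `east ω′` into λ.
      below-tail : Below ω′
      below-tail with Q-cover H.hook-length n′≤n
      ... | p , p∈ , d with row p ≤? row ω′
      ...   | yes r≤ = p , p∈ , same-diagonal {α} {n′} p ω′ d H′.hook-length r≤
      ...   | no r≰ = contradiction
        (InShape-≤ (Q-inShape p∈) (proj₁ H′.tail-in) (s≤s z≤n) (<⇒≤ (≰⇒> r≰)) c<)
        H′.tail-right
        where
        c< : col ω′ < col p
        c< = +-cancelʳ-< a (col ω′) (col p) (<-≤-trans
          (≤-trans (s≤s (≤-reflexive H′.hook-length)) (+-monoʳ-< (n′ + b) (≰⇒> r≰)))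
          (≤-reflexive (sym d)))

      unshift-bound : ∀ k p → p ∈ Q → S (shift b (shift k p)) → S (shift b p)
      unshift-bound k p p∈ sh = InShape-unshift (k + b) (Q-inShape p∈) (m≤n+m b k)
        (subst S (shift-shift k b p) sh)

      -- If the old path enters p from the west, shift that cell k times. If it enters from the
      -- south, the tie excludes k = 0, and otherwise the western cell is `south p` shifted one time
      -- fewer.
      below-west : ∀ {n i j} → Below (i , suc j) → AtOffset α (suc n) (i , suc j) →
                   (S (suc i , suc j) → π (i , suc j) < π (suc i , suc j)) → Below (i , j)
      below-west {n} (p , p∈ , k , eq) d lt
        with Q-pred p∈ (offset-unshift {α} {suc n} k p (subst (AtOffset α (suc n)) eq d))
      below-west (_ , p∈ , k , refl) d lt | inj₁ (q , refl , q∈) = q , q∈ , k , refl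
      below-west ((x , y) , p∈ , zero , eq) d lt | inj₂ (s∈ , πeq)
        with trans eq (shift-0 (x , y))
      ... | refl = contradiction πeq (<⇒≢ (lt (Q-inShape s∈)))
      below-west ((x , y) , p∈ , suc k , eq) d lt | inj₂ (s∈ , πeq) = (suc x , y) , s∈ , k ,
        cong₂ _,_ (trans (cong row eq) (+-suc x k))
                  (suc-injective (trans (cong col eq) (+-suc y k)))

      below-south : ∀ {n v} → Below v → AtOffset α (suc n) v → S (south v) →
                    π v ≡ π (south v) → Below (south v)
      below-south {n} (p , p∈ , k , refl) d s πeq
        with Q-pred p∈ (offset-unshift {α} {suc n} k p d)
      ... | inj₁ (q , refl , q∈) = q , q∈ , suc k , sym (shift-suc k q)
      ... | inj₂ (s∈ , _) = south p , s∈ , k , refl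

      -- Column 1 forces k = 0, so the cell is on the old path, which there could only have
      -- continued south, at a tie.
      wall : ∀ {n i} → Below (i , 1) → AtOffset α (suc n) (i , 1) → S (suc i , 1) →
             π (suc i , 1) ≤ π (i , 1)
      wall {n} {i} (p , p∈ , k , eq) d s
        with trans eq (shift-col-≤ k p (≤-trans (≤-reflexive (cong col (sym eq)))
                                                (proj₁ (proj₂ (Q-inShape p∈)))))
      ... | refl with Q-pred p∈ d
      ...   | inj₁ (_ , refl , q∈) = contradiction (proj₁ (proj₂ (Q-inShape q∈))) λ ()
      ...   | inj₂ (_ , πeq) = ≤-reflexive (sym πeq)

    ready-next : (row ω′ , b′) ≤revlex (row ω , b) → Ready π α′ ω′
    ready-next (inj₁ b<b′) = ready-new-column b<b′
    ready-next (inj₂ (eq , r≤r′)) = ready-same-column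
      (cong₂ _,_ (≤-antisym a≤a′ a′≤a) (sym eq)) r≤r′
      where
      a′≤a : a′ ≤ a
      a′≤a = ≮⇒≥ λ a<a′ → H.head-bottom
        (InShape-≤ H′.head-in (s≤s z≤n) (proj₁ (proj₂ H.head-in)) a<a′ (≤-reflexive (sym eq)))
      a≤a′ : a ≤ a′
      a≤a′ = ≮⇒≥ λ a′<a → H′.head-bottom
        (InShape-≤ H.head-in (s≤s z≤n) (proj₁ (proj₂ H′.head-in)) a′<a (≤-reflexive eq))

  -- Inserting the whole sequence

  LastStatus : List Path → RPP → Set
  LastStatus [] π = π ≡ zeroRPP
  LastStatus (h ∷ _) π = Status π (head h) (tail h)

  -- The status left by the latest hook is all that the next insertion uses, so comparing adjacent
  -- hooks suffices.
  insert-all : ∀ hs → All (IsRimHook lam) hs → Linked _≤hook_ hs →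
               Σ RPP λ π → InsertChain lam hs π × LastStatus hs π
  insert-all [] _ _ = zeroRPP , done , refl
  insert-all (h ∷ hs) (rh ∷ rhs) l = next hs rhs l
    where
    hook : Hook (head h) (tail h) (len h)
    hook = rimHook⇒hook rh
    insert : ∀ {hs π} → InsertChain lam hs π → Ready π (head h) (tail h) →
             Σ RPP λ π′ → InsertChain lam (h ∷ hs) π′ × LastStatus (h ∷ hs) π′
    insert chain ready = _ , step _ chain (insertionPath ready hook h refl refl) , status ready hook
    next : ∀ hs → All (IsRimHook lam) hs → Linked _≤hook_ (h ∷ hs) →
           Σ RPP λ π → InsertChain lam (h ∷ hs) π × LastStatus (h ∷ hs) π
    next [] _ _ = insert done (ready-zero hook)
    next (f ∷ hs) (rf ∷ rhs) (h≤f ∷ l) with insert-all (f ∷ hs) (rf ∷ rhs) l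
    ... | π , chain , st = insert chain (ready-next st (rimHook⇒hook rf) hook h≤f)

theorem3 : (lam : Partition) → IsPartition lam →
    (hs : List Path) → All (IsRimHook lam) hs → Linked _≤hook_ hs →
    Σ RPP (λ ρ → InsertChain lam hs ρ × IsRPP lam ρ)
theorem3 lam (antitone , _) hs rhs l with insert-all lam antitone hs rhs l
theorem3 lam (antitone , _) [] _ _ | π , chain , refl =
  π , chain , λ _ _ → (λ _ → z≤n) , (λ _ → z≤n)
theorem3 lam (antitone , _) (_ ∷ _) _ _ | π , chain , st = π , chain , Status.isRPP st
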